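{- Let $2\le k<n$. If $n$ is even and $S(n-2,k-2)$ is odd, then there does not exist a ucycle for the $k$-partitions of $[n]$.
   Context: $[m]=\{1,\dots,m\}$. A $k$-partition of $[n]$ is a partition of $[n]$ into exactly $k$ nonempty parts; $S(n,k)$ (Stirling number of the second kind) is the number of these, with $S(m,0)=0$ for $m\ge 1$. A string $r_1\cdots r_n$ over the alphabet $[k]$ represents a $k$-partition $p$ of $[n]$ if $r_i=r_j$ iff $i,j$ lie in the same part of $p$. A ucycle for the $k$-partitions of $[n]$ is a cyclic string $a_1\cdots a_N$ over the alphabet $[k]$, $N=S(n,k)$, indices modulo $N$, such that each $k$-partition of $[n]$ is represented by exactly one of the windows $a_ia_{i+1}\cdots a_{i+n-1}$, $1\le i\le N$. -}

module Defs where

open import Data.Fin using (Fin; toℕ)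
open import Data.Fin.Properties using (nonZeroIndex) renaming (all? to ∀Fin?)
open import Data.Fin.Subset using (Subset; inside; outside; _∈_; _∩_; Nonempty; Empty)
open import Data.Fin.Subset.Properties using (_∈?_; nonempty?)
open import Data.List using (List; []; _∷_; _++_; map; filter; length)
open import Data.List.Relation.Unary.All using (All; all?)
open import Data.List.Relation.Unary.AllPairs using (AllPairs; allPairs?)
open import Data.List.Relation.Unary.Any using (Any; any?)
open import Data.Nat using (ℕ; zero; suc; _+_; _≟_)
open import Data.Nat.DivMod using (_mod_)
open import Data.Product using (∃!; _×_; _,_)
open import Data.Vec using ([]; _∷_)
open import Data.Vec.Functional using (Vector)
open import Function.Bundles using (_⇔_)
open import Relation.Binary.PropositionalEquality using (_≡_)
open import Relation.Nullary using (Dec)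
open import Relation.Nullary.Decidable using (map′; ¬?; _×-dec_)

-- [ n ] is modelled by Fin n.  Parts are nonempty and pairwise disjoint, hence
-- distinct, so the length of the list P is the number of parts.
record IsPartition (n k : ℕ) (P : List (Subset n)) : Set where
  constructor isPartition
  field
    nonempty : All Nonempty P
    disjoint : AllPairs (λ p q → Empty (p ∩ q)) P
    covers   : ∀ i → Any (i ∈_) P
    parts    : length P ≡ k

isPartition? : ∀ n k (P : List (Subset n)) → Dec (IsPartition n k P)
isPartition? n k P = map′
  (λ (a , b , c , d) → isPartition a b c d)
  (λ (isPartition a b c d) → a , b , c , d)
  (all? nonempty? P
    ×-dec allPairs? (λ p q → ¬? (nonempty? (p ∩ q))) P
    ×-dec ∀Fin? (λ i → any? (i ∈?_) P)
    ×-dec (length P ≟ k))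

subsets : ∀ n → List (Subset n)
subsets zero    = [] ∷ []
subsets (suc n) = map (inside ∷_) (subsets n) ++ map (outside ∷_) (subsets n)

sublists : {A : Set} → List A → List (List A)
sublists []       = [] ∷ []
sublists (x ∷ xs) = map (x ∷_) (sublists xs) ++ sublists xs

-- A list satisfying IsPartition may enumerate the parts in any order.  The
-- sublists of `subsets n` list every set of subsets of Fin n exactly once, in
-- the order of `subsets n`, so each k-partition is counted once.
S : ℕ → ℕ → ℕ
S n k = length (filter (isPartition? n k) (sublists (subsets n)))

SamePart : ∀ {n} → List (Subset n) → Fin n → Fin n → Set
SamePart P i j = Any (λ p → i ∈ p × j ∈ p) P

Represents : ∀ {n k} → Vector (Fin k) n → List (Subset n) → Set
Represents r P = ∀ i j → r i ≡ r j ⇔ SamePart P i j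

window : ∀ {A : Set} {N} n → Vector A N → Fin N → Vector A n
window {N = N} n a i j = a (((toℕ i + toℕ j) mod N) {{nonZeroIndex i}})

IsUcycle : ∀ n k → Vector (Fin k) (S n k) → Set
IsUcycle n k a =
  ∀ P → IsPartition n k P → ∃! _≡_ λ i → Represents (window n a i) P

{-# OPTIONS --safe #-}
module Submission where

-- Rank the letters of [k] by their next occurrence after position m, with a_m
-- itself first.  Passing from position m + 1 to position m moves a_m to the
-- front, so the sign of this ordering changes by (-1)^r, where r is the number of
-- distinct letters strictly between a_m and its next occurrence.  After a full
-- turn the ordering is the initial one; hence the sum of these r is even.  Each r
-- depends only on the partition represented by the window at m, so the sum runs
-- over all k-partitions, and equals
--   (k choose 2) S(n-1,k) + (k-1) S(n-1,k-1).
-- For even n this is congruent to S(n-2,k-2) modulo 2.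

open import Defs
open import Data.Bool as Bool using (true; false)
open import Data.Empty using (⊥-elim)
open import Data.Fin as Fin using (Fin; zero; suc; toℕ)
import Data.Fin.Properties as Fin
open import Data.Fin.Subset as Subset using (Subset; inside; outside)
import Data.Fin.Subset.Properties as Subset
open import Data.List using (List; []; _∷_; _++_; map; filter; length; tabulate; allFin; downFrom; cartesianProductWith; deduplicate)
open import Data.List.Extrema.Nat using (max; xs≤max)
open import Data.List.Membership.Propositional using (_∈_; _∉_; find; lose)
open import Data.List.Membership.Propositional.Properties
open import Data.List.Properties hiding (sum-++)
open import Data.List.Relation.Binary.Permutation.Propositional using (_↭_; ↭-refl; ↭-trans; prep)
open import Data.List.Relation.Binary.Permutation.Propositional.Properties using (shift; ↭-length; ∈-resp-↭; map⁺)
open import Data.List.Relation.Binary.Subset.Propositional using (_⊆_)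
open import Data.List.Relation.Unary.All as All using (All; []; _∷_)
import Data.List.Relation.Unary.All.Properties as All
open import Data.List.Relation.Unary.AllPairs using (AllPairs; []; _∷_)
open import Data.List.Relation.Unary.Any as Any using (Any; here; there)
import Data.List.Relation.Unary.Unique.DecPropositional.Properties as DecUnique
open import Data.List.Relation.Unary.Unique.Propositional using (Unique)
import Data.List.Relation.Unary.Unique.Propositional.Properties as Unique
open import Data.Maybe using (just; nothing)
open import Data.Nat as ℕ using (ℕ; zero; suc; parity; _+_; _*_; _∸_; _≤_; _<_; s≤s; z<s; s<s)
open import Data.Nat.Divisibility using (_∣_; _∤_; divides; _∣0; ∣m∣n⇒∣m+n; ∣-refl)
open import Data.Nat.DivMod using (_%_; _mod_; m%n<n; m%n%n≡m%n; n%n≡0; %-distribˡ-+)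
open import Data.Nat.ListAction using (sum)
open import Data.Nat.ListAction.Properties using (sum-++; sum-↭)
open import Data.Nat.Properties
import Data.Nat.Tactic.RingSolver as ℕ-Solver
open import Data.Parity.Base using (Parity; 0ℙ; 1ℙ) renaming (_+_ to infixl 6 _⊕_; _*_ to infixl 7 _⊗_)
import Data.Parity.Properties as ℙ
open import Data.Product using (∃; _×_; _,_; proj₁; proj₂)
open import Data.Sum using (_⊎_; inj₁; inj₂; [_,_]′)
open import Data.Vec as Vec using ([]; _∷_)
open import Data.Vec.Functional as Vector using (Vector)
import Data.Vec.Properties as Vec
open import Function using (_∘_; id; case_of_; _⇔_; mk⇔; Equivalence)
import Function.Properties.Equivalence as ⇔
open import Level using (0ℓ)
open import Relation.Binary using (DecidableEquality)
open import Relation.Binary.PropositionalEquality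
open import Relation.Nullary
open import Relation.Nullary.Decidable using (dec-true)
open import Tactic.RingSolver using (solve-∀)
open import Tactic.RingSolver.Core.AlmostCommutativeRing using (AlmostCommutativeRing; fromCommutativeRing)

-- Parities as a ring, and lists without repetitions

ℤ₂ : AlmostCommutativeRing 0ℓ 0ℓ
ℤ₂ = fromCommutativeRing ℙ.+-*-commutativeRing λ where
  -- This zero test makes characteristic 2 visible to the solver: a coefficient `1ℙ ⊕ 1ℙ` evaluates
  -- to `0ℙ` and is dropped.
  0ℙ → just refl
  1ℙ → nothing

-- Induction on `xs`: delete one occurrence of its head from `ys`. The tail avoids that element, so
-- it still embeds in what remains.
unique-⊆ : ∀ {A : Set} {xs ys : List A} → Unique xs → xs ⊆ ys → ∃ λ zs → ys ↭ xs ++ zs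
unique-⊆ {ys = ys} [] _ = ys , ↭-refl
unique-⊆ {xs = x ∷ xs} {ys} (x∉xs ∷ xs!) xs⊆ys
  with us , vs , refl ← ∈-∃++ (xs⊆ys (here refl))
  with zs , us++vs↭ ← unique-⊆ {ys = us ++ vs} xs! (λ {y} y∈xs →
         [ ∈-++⁺ˡ
         , (λ where (here y≡x)   → contradiction (sym y≡x) (All.lookup x∉xs y∈xs)
                    (there y∈vs) → ∈-++⁺ʳ us y∈vs)
         ]′ (∈-++⁻ us (xs⊆ys (there y∈xs))))
  = zs , ↭-trans (shift x us vs) (prep x us++vs↭)

unique-⊆-length : ∀ {A : Set} {xs ys : List A} → Unique xs → xs ⊆ ys → length xs ≤ length ys
unique-⊆-length {xs = xs} xs! xs⊆ys with zs , ys↭ ← unique-⊆ xs! xs⊆ys =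
  subst (length xs ≤_) (sym (trans (↭-length ys↭) (length-++ xs))) (m≤m+n _ _)

-- Pigeonhole: a leftover element would make `ys` strictly longer than `xs`.
unique-⊆-↭ : ∀ {A : Set} {xs ys : List A} → Unique xs → xs ⊆ ys → length ys ≤ length xs → ys ↭ xs
unique-⊆-↭ {xs = xs} {ys} xs! xs⊆ys ys≤xs with unique-⊆ xs! xs⊆ys
... | [] , ys↭ = subst (ys ↭_) (++-identityʳ xs) ys↭
... | z ∷ zs , ys↭ = contradiction ys≤xs (<⇒≱ (subst (length xs <_)
        (sym (trans (↭-length ys↭) (length-++ xs))) (m<m+n _ z<s)))

-- Move-to-front codes

-- A partition of [n] is read from n down to 1.  An element whose part has been
-- seen is coded by the rank of that part in the order of most recent
-- occurrence; an element opening a new part is coded by the number of parts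
-- seen so far.
data IsCode : ℕ → List ℕ → Set where
  []  : IsCode 0 []
  old : ∀ {c k cs} → c < k → IsCode k cs → IsCode k (c ∷ cs)
  new : ∀ {k cs} → IsCode k cs → IsCode (suc k) (k ∷ cs)

-- The tail determines the number of parts seen so far. A head below that number repeats a part, a
-- head equal to it opens one, so the two cases never overlap.
isCode-unique : ∀ {k l cs} → IsCode k cs → IsCode l cs → k ≡ l
isCode-unique []          []          = refl
isCode-unique (old _ p)   (old _ q)   = isCode-unique p q
isCode-unique (old c<k p) (new q)     = contradiction (isCode-unique p q) (>⇒≢ c<k)
isCode-unique (new p)     (old c<l q) = contradiction (isCode-unique q p) (>⇒≢ c<l)
isCode-unique (new p)     (new q)     = refl

-- The two summands mirror the recurrence S(n+1,k+1) = (k+1) S(n,k+1) + S(n,k), and the heads can be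
-- read off each summand.
codes : ℕ → ℕ → List (List ℕ)
codes zero    zero    = [] ∷ []
codes zero    (suc k) = []
codes (suc n) zero    = []
codes (suc n) (suc k) =
  cartesianProductWith _∷_ (downFrom (suc k)) (codes n (suc k)) ++ map (k ∷_) (codes n k)

∈-codes⁺ : ∀ {k cs} → IsCode k cs → cs ∈ codes (length cs) k
∈-codes⁺ [] = here refl
∈-codes⁺ {suc k} (old c<k p) = ∈-++⁺ˡ (∈-cartesianProductWith⁺ _∷_ (∈-downFrom⁺ c<k) (∈-codes⁺ p))
∈-codes⁺ {suc k} {_ ∷ cs} (new p) =
  ∈-++⁺ʳ (cartesianProductWith _∷_ (downFrom (suc k)) (codes (length cs) (suc k)))
         (∈-map⁺ (k ∷_) (∈-codes⁺ p))

∈-codes⁻ : ∀ n k {cs} → cs ∈ codes n k → length cs ≡ n × IsCode k cs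
∈-codes⁻ zero    zero    (here refl) = refl , []
∈-codes⁻ (suc n) (suc k) cs∈
  with ∈-++⁻ (cartesianProductWith _∷_ (downFrom (suc k)) (codes n (suc k))) cs∈
... | inj₁ p with c , ds , c∈ , ds∈ , refl ←
                    ∈-cartesianProductWith⁻ _∷_ (downFrom (suc k)) (codes n (suc k)) p
             with len , ds✓ ← ∈-codes⁻ n (suc k) ds∈ = cong suc len , old (∈-downFrom⁻ c∈) ds✓
... | inj₂ p with ds , ds∈ , refl ← ∈-map⁻ (k ∷_) p
             with len , ds✓ ← ∈-codes⁻ n k ds∈ = cong suc len , new ds✓

codes-unique : ∀ n k → Unique (codes n k)
codes-unique zero    zero    = [] ∷ []
codes-unique zero    (suc k) = []
codes-unique (suc n) zero    = []
codes-unique (suc n) (suc k) = Unique.++⁺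
  (Unique.cartesianProductWith⁺ _∷_ ∷-injective (Unique.downFrom⁺ (suc k)) (codes-unique n (suc k)))
  (Unique.map⁺ ∷-injectiveʳ (codes-unique n k))
  -- A code in both halves would have a tail with both `suc k` and `k` parts.
  λ (p , q) → let c , ds , _ , ds∈ , e = ∈-cartesianProductWith⁻ _∷_ (downFrom (suc k)) (codes n (suc k)) p
                  ds′ , ds′∈ , e′ = ∈-map⁻ (k ∷_) q
                  ds≡ds′ = ∷-injectiveʳ (trans (sym e) e′)
              in 1+n≢n (isCode-unique (subst (IsCode (suc k)) ds≡ds′ (proj₂ (∈-codes⁻ n (suc k) ds∈)))
                                      (proj₂ (∈-codes⁻ n k ds′∈)))

module Words {A : Set} (_≟_ : DecidableEquality A) where

  remove : A → List A → List A
  remove x = filter (¬? ∘ (x ≟_))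

  -- Lists the letters by first occurrence. `dedup (x ∷ v)` unfolds to `x ∷ remove x (dedup v)`, so
  -- prepending a letter is exactly the move-to-front step.
  dedup : List A → List A
  dedup = deduplicate _≟_

  -- The rank of an absent letter is the length of the list: exactly the code of
  -- a new part.
  rank : A → List A → ℕ
  rank x [] = 0
  rank x (y ∷ ys) with x ≟ y
  ... | yes _ = 0
  ... | no  _ = suc (rank x ys)

  code : List A → List ℕ
  code []      = []
  code (x ∷ v) = rank x (dedup v) ∷ code v

  length-code : ∀ v → length (code v) ≡ length v
  length-code []      = refl
  length-code (_ ∷ v) = cong suc (length-code v)

  dedup-unique : ∀ v → Unique (dedup v)
  dedup-unique = DecUnique.deduplicate-! _≟_

  remove-∉ : ∀ {x L} → x ∉ L → remove x L ≡ L
  remove-∉ x∉L = filter-all _ (All.¬Any⇒All¬ _ x∉L)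

  rank-self : ∀ {x L} → rank x (x ∷ L) ≡ 0
  rank-self {x} with x ≟ x
  ... | yes _  = refl
  ... | no x≢x = contradiction refl x≢x

  rank-∈ : ∀ {x L} → x ∈ L → rank x L < length L
  rank-∈ {x} {y ∷ L} x∈ with x ≟ y | x∈
  ... | yes _  | _         = z<s
  ... | no x≢y | here x≡y  = contradiction x≡y x≢y
  ... | no _   | there x∈L = s<s (rank-∈ x∈L)

  rank-∉ : ∀ {x L} → x ∉ L → rank x L ≡ length L
  rank-∉ {L = []} _ = refl
  rank-∉ {x} {y ∷ L} x∉ with x ≟ y
  ... | yes x≡y = contradiction (here x≡y) x∉
  ... | no _    = cong suc (rank-∉ (x∉ ∘ there))

  -- It suffices that `y` is present: its rank is then below the length of `L`, which no absent `x`
  -- attains.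
  rank-injective : ∀ {x y L} → y ∈ L → rank x L ≡ rank y L → x ≡ y
  rank-injective {x} {y} {z ∷ L} y∈ eq with x ≟ z | y ≟ z | y∈
  ... | yes x≡z | yes y≡z | _         = trans x≡z (sym y≡z)
  ... | no  _   | no  y≢z | here y≡z  = contradiction y≡z y≢z
  ... | no  _   | no  _   | there y∈L = rank-injective y∈L (suc-injective eq)

  rank-∉-snoc : ∀ {x} L → x ∉ L → rank x (L ++ x ∷ []) ≡ rank x L
  rank-∉-snoc {x} [] _ = rank-self {x}
  rank-∉-snoc {x} (y ∷ L) x∉ with x ≟ y
  ... | yes x≡y = contradiction (here x≡y) x∉
  ... | no _    = cong suc (rank-∉-snoc L (x∉ ∘ there))

  length-remove : ∀ {x L} → Unique L → x ∈ L → suc (length (remove x L)) ≡ length L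
  length-remove {x} {y ∷ L} (y∉L ∷ L!) x∈ with x ≟ y | x∈
  ... | yes refl | _         = cong (suc ∘ length) (remove-∉ (All.All¬⇒¬Any y∉L))
  ... | no x≢y   | here x≡y  = contradiction x≡y x≢y
  ... | no _     | there x∈L = cong suc (length-remove L! x∈L)

  code-isCode : ∀ v → IsCode (length (dedup v)) (code v)
  code-isCode [] = []
  code-isCode (x ∷ v) with Any.any? (x ≟_) (dedup v)
  ... | yes x∈ rewrite length-remove (dedup-unique v) x∈ = old (rank-∈ x∈) (code-isCode v)
  ... | no  x∉ rewrite remove-∉ x∉ | rank-∉ x∉ = new (code-isCode v)

  remove-++ : ∀ x L M → remove x (L ++ M) ≡ remove x L ++ remove x M
  remove-++ x = filter-++ (¬? ∘ (x ≟_))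

  dedup-snoc-∉ : ∀ {y} v → y ∉ v → dedup (v ++ y ∷ []) ≡ dedup v ++ y ∷ []
  dedup-snoc-∉ [] _ = refl
  dedup-snoc-∉ {y} (x ∷ v) y∉ = cong (x ∷_) (begin
    remove x (dedup (v ++ y ∷ []))           ≡⟨ cong (remove x) (dedup-snoc-∉ v (y∉ ∘ there)) ⟩
    remove x (dedup v ++ y ∷ [])             ≡⟨ remove-++ x (dedup v) _ ⟩
    remove x (dedup v) ++ remove x (y ∷ [])  ≡⟨ cong (remove x (dedup v) ++_)
                                                  (filter-accept (¬? ∘ (x ≟_)) (y∉ ∘ here ∘ sym)) ⟩
    remove x (dedup v) ++ y ∷ []             ∎)
    where open ≡-Reasoning

  dedup-snoc-∈ : ∀ {y} v → y ∈ v → dedup (v ++ y ∷ []) ≡ dedup v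
  dedup-snoc-∈ {y} (x ∷ v) y∈ with Any.any? (y ≟_) v | y∈
  ... | yes y∈v | _         = cong (λ L → x ∷ remove x L) (dedup-snoc-∈ v y∈v)
  ... | no y∉v  | there y∈v = contradiction y∈v y∉v
  ... | no y∉v  | here refl = cong (x ∷_) (begin
    remove x (dedup (v ++ x ∷ []))           ≡⟨ cong (remove x) (dedup-snoc-∉ v y∉v) ⟩
    remove x (dedup v ++ x ∷ [])             ≡⟨ remove-++ x (dedup v) _ ⟩
    remove x (dedup v) ++ remove x (x ∷ [])  ≡⟨ cong (remove x (dedup v) ++_)
                                                  (filter-reject (¬? ∘ (x ≟_)) (λ x≢x → x≢x refl)) ⟩
    remove x (dedup v) ++ []                 ≡⟨ ++-identityʳ _ ⟩
    remove x (dedup v)                       ∎)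
    where open ≡-Reasoning

-- Codes characterise the equality pattern of a word

module SamePattern {A B : Set} (_≟₁_ : DecidableEquality A) (_≟₂_ : DecidableEquality B) where

  private
    module W₁ = Words _≟₁_
    module W₂ = Words _≟₂_

  module _ {J : Set} (f : J → A) (g : J → B) (f~g : ∀ i j → f i ≡ f j ⇔ g i ≡ g j) where

    -- Both words are tracked through one list of positions. Equal patterns make the same decisions,
    -- so a single `is′` serves both alphabets.
    remove-map : ∀ j is → ∃ λ is′ →
      W₁.remove (f j) (map f is) ≡ map f is′ × W₂.remove (g j) (map g is) ≡ map g is′
    remove-map j [] = [] , refl , refl
    remove-map j (i ∷ is) with is′ , p , q ← remove-map j is | f j ≟₁ f i | g j ≟₂ g i
    ... | yes _  | yes _  = is′ , p , q
    ... | no _   | no _   = i ∷ is′ , cong (f i ∷_) p , cong (g i ∷_) q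
    ... | yes e  | no ¬e  = contradiction (Equivalence.to (f~g j i) e) ¬e
    ... | no ¬e  | yes e  = contradiction (Equivalence.from (f~g j i) e) ¬e

    dedup-map : ∀ js → ∃ λ is → W₁.dedup (map f js) ≡ map f is × W₂.dedup (map g js) ≡ map g is
    dedup-map [] = [] , refl , refl
    dedup-map (j ∷ js) with is , p , q ← dedup-map js with is′ , p′ , q′ ← remove-map j is =
      j ∷ is′ ,
      cong (f j ∷_) (trans (cong (W₁.remove (f j)) p) p′) ,
      cong (g j ∷_) (trans (cong (W₂.remove (g j)) q) q′)

    rank-map : ∀ j is → W₁.rank (f j) (map f is) ≡ W₂.rank (g j) (map g is)
    rank-map j [] = refl
    rank-map j (i ∷ is) with f j ≟₁ f i | g j ≟₂ g i
    ... | yes _  | yes _  = refl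
    ... | no _   | no _   = cong suc (rank-map j is)
    ... | yes e  | no ¬e  = contradiction (Equivalence.to (f~g j i) e) ¬e
    ... | no ¬e  | yes e  = contradiction (Equivalence.from (f~g j i) e) ¬e

    rank-dedup-map : ∀ j js →
      W₁.rank (f j) (W₁.dedup (map f js)) ≡ W₂.rank (g j) (W₂.dedup (map g js))
    rank-dedup-map j js with is , p , q ← dedup-map js rewrite p | q = rank-map j is

    code-map : ∀ js → W₁.code (map f js) ≡ W₂.code (map g js)
    code-map []       = refl
    code-map (j ∷ js) = cong₂ _∷_ (rank-dedup-map j js) (code-map js)

  code-cong : ∀ {n} (f : Vector A n) (g : Vector B n) → (∀ i j → f i ≡ f j ⇔ g i ≡ g j) →
              W₁.code (tabulate f) ≡ W₂.code (tabulate g)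
  code-cong {n} f g f~g =
    subst₂ (λ v w → W₁.code v ≡ W₂.code w) (map-tabulate id f) (map-tabulate id g)
           (code-map f g f~g (allFin n))

  -- By induction the tails have the same pattern, so corresponding tail letters have equal ranks in
  -- both words. The common code of the heads then makes each head equal to the same tail letters.
  code-injective : ∀ {n} (f : Vector A n) (g : Vector B n) →
                   W₁.code (tabulate f) ≡ W₂.code (tabulate g) → ∀ i j → f i ≡ f j ⇔ g i ≡ g j
  code-injective {suc n} f g eq = λ where
      zero    zero    → mk⇔ (λ _ → refl) (λ _ → refl)
      zero    (suc j) → head~ j
      (suc i) zero    → mk⇔ (sym ∘ Equivalence.to (head~ i) ∘ sym)
                            (sym ∘ Equivalence.from (head~ i) ∘ sym)
      (suc i) (suc j) → tail~ i j
    where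
    f′ : Vector A n
    f′ = f ∘ suc
    g′ : Vector B n
    g′ = g ∘ suc
    heads : W₁.rank (f zero) (W₁.dedup (tabulate f′)) ≡ W₂.rank (g zero) (W₂.dedup (tabulate g′))
    heads = ∷-injectiveˡ eq
    tail~ : ∀ i j → f′ i ≡ f′ j ⇔ g′ i ≡ g′ j
    tail~ = code-injective f′ g′ (∷-injectiveʳ eq)
    ranks : ∀ j → W₁.rank (f′ j) (W₁.dedup (tabulate f′)) ≡ W₂.rank (g′ j) (W₂.dedup (tabulate g′))
    ranks j = subst₂ (λ v w → W₁.rank (f′ j) (W₁.dedup v) ≡ W₂.rank (g′ j) (W₂.dedup w))
      (map-tabulate id f′) (map-tabulate id g′) (rank-dedup-map f′ g′ tail~ j (allFin n))
    head~ : ∀ j → f zero ≡ f′ j ⇔ g zero ≡ g′ j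
    head~ j = mk⇔
      (λ e → W₂.rank-injective (∈-deduplicate⁺ _≟₂_ (∈-tabulate⁺ j))
               (trans (sym heads) (trans (cong (λ x → W₁.rank x (W₁.dedup (tabulate f′))) e) (ranks j))))
      (λ e → W₁.rank-injective (∈-deduplicate⁺ _≟₁_ (∈-tabulate⁺ j))
               (trans heads (trans (cong (λ x → W₂.rank x (W₂.dedup (tabulate g′))) e) (sym (ranks j)))))

-- Every code comes from a word

module _ where
  open Words ℕ._≟_

  rank-surjective : ∀ {c} L → Unique L → c ≤ length L → ∃ λ x → rank x L ≡ c
  rank-surjective L L! c≤ with m≤n⇒m<n∨m≡n c≤
  -- A rank equal to the length calls for an absent letter. The alphabet ℕ always offers one: the
  -- successor of the maximum.
  ... | inj₂ refl = suc (max 0 L) , rank-∉ λ x∈L → 1+n≰n (All.lookup (xs≤max 0 L) x∈L)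
  ... | inj₁ c<   = let x , _ , e = go L L! c< in x , e
    where
    go : ∀ {c} L → Unique L → c < length L → ∃ λ x → x ∈ L × rank x L ≡ c
    go {zero}  (y ∷ L) _ _ = y , here refl , rank-self {y} {L}
    go {suc c} (y ∷ L) (y∉L ∷ L!) (s≤s c<) with x , x∈L , e ← go L L! c< =
      x , there x∈L , rank-suc
      where
      rank-suc : rank x (y ∷ L) ≡ suc c
      rank-suc with x ℕ.≟ y
      ... | yes x≡y = contradiction (sym x≡y) (All.lookup y∉L x∈L)
      ... | no _    = cong suc e

  decode : ∀ {k cs} → IsCode k cs → ∃ λ (f : Vector ℕ (length cs)) → code (tabulate f) ≡ cs
  -- Old and new entries both satisfy `c ≤ k`, which is all that is needed to choose a first letter
  -- of rank `c` in front of the decoded tail.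
  decode-cons : ∀ {c k cs} → IsCode k cs → c ≤ k →
                ∃ λ (f : Vector ℕ (suc (length cs))) → code (tabulate f) ≡ c ∷ cs

  decode []          = Vector.[] , refl
  decode (old c<k p) = decode-cons p (<⇒≤ c<k)
  decode (new p)     = decode-cons p ≤-refl

  decode-cons {c} {k} {cs} p c≤k with f , e ← decode p
    with x , r ← rank-surjective (dedup (tabulate f)) (dedup-unique (tabulate f))
           (subst (c ≤_) (isCode-unique p (subst (IsCode _) e (code-isCode (tabulate f)))) c≤k)
    = (x Vector.∷ f) , cong₂ _∷_ r e

-- The sign of an ordering under move-to-front

module Inversions {k : ℕ} where
  open Words (Fin._≟_ {k})

  _<ℙ_ : Fin k → Fin k → Parity
  x <ℙ y with x Fin.<? y
  ... | yes _ = 1ℙ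
  ... | no  _ = 0ℙ

  <ℙ-total : ∀ {x y} → x ≢ y → x <ℙ y ≡ 1ℙ ⊕ (y <ℙ x)
  <ℙ-total {x} {y} x≢y with x Fin.<? y | y Fin.<? x
  ... | yes x<y | yes y<x = contradiction y<x (<⇒≯ x<y)
  ... | yes _   | no _    = refl
  ... | no _    | yes _   = refl
  ... | no x≮y  | no y≮x  = contradiction (Fin.≤-antisym (≮⇒≥ y≮x) (≮⇒≥ x≮y)) x≢y

  below : Fin k → List (Fin k) → Parity
  below x []      = 0ℙ
  below x (y ∷ L) = (y <ℙ x) ⊕ below x L

  -- The sign of the list as an ordering of its letters, written additively.
  inversions : List (Fin k) → Parity
  inversions []      = 0ℙ
  inversions (x ∷ L) = below x L ⊕ inversions L

  below-remove : ∀ {x} y {L} → Unique L → x ∈ L → below y L ≡ (x <ℙ y) ⊕ below y (remove x L)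
  below-remove {x} y {z ∷ L} (z∉L ∷ L!) x∈ with x Fin.≟ z | x∈
  ... | yes refl | _ = cong (λ M → (x <ℙ y) ⊕ below y M) (sym (remove-∉ (All.All¬⇒¬Any z∉L)))
  ... | no x≢z | here x≡z = contradiction x≡z x≢z
  ... | no _ | there x∈L = trans (cong ((z <ℙ y) ⊕_) (below-remove y L! x∈L))
                                 (swap (z <ℙ y) (x <ℙ y) (below y (remove x L)))
    where
    swap : ∀ p q r → p ⊕ (q ⊕ r) ≡ q ⊕ (p ⊕ r)
    swap = solve-∀ ℤ₂

  -- On its way to the front `x` passes `rank x L` letters, and each passage reverses the order of
  -- one pair.
  inversions-move : ∀ {x L} → Unique L → x ∈ L →
                    inversions (x ∷ remove x L) ⊕ inversions L ≡ parity (rank x L)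
  inversions-move {x} {y ∷ L} (y∉L ∷ L!) x∈ with x Fin.≟ y | x∈
  ... | no x≢y | here x≡y = contradiction x≡y x≢y
  ... | yes refl | _ rewrite remove-∉ (All.All¬⇒¬Any y∉L) = ℙ.p+p≡0ℙ (below y L ⊕ inversions L)
  ... | no x≢y | there x∈L
    rewrite below-remove y L! x∈L | <ℙ-total x≢y = begin
    -- In passing `y`, only the pair of `x` and `y` changes order: it contributes `p` to one list
    -- and `1ℙ ⊕ p` to the other.
    (p ⊕ below x R) ⊕ (below y R ⊕ inversions R) ⊕ ((1ℙ ⊕ p) ⊕ below y R ⊕ inversions L)
      ≡⟨ rearrange p (below x R) (below y R) (inversions R) (inversions L) ⟩
    1ℙ ⊕ (inversions (x ∷ R) ⊕ inversions L)
      ≡⟨ cong (1ℙ ⊕_) (inversions-move L! x∈L) ⟩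
    1ℙ ⊕ parity (rank x L)
      ≡⟨ ℙ.+-homo-+ 1 (rank x L) ⟨
    parity (suc (rank x L)) ∎
    where
    open ≡-Reasoning
    p : Parity
    p = y <ℙ x
    R : List (Fin k)
    R = remove x L
    rearrange : ∀ p b c d e → (p ⊕ b) ⊕ (c ⊕ d) ⊕ ((1ℙ ⊕ p) ⊕ c ⊕ e) ≡ 1ℙ ⊕ ((b ⊕ d) ⊕ e)
    rearrange = solve-∀ ℤ₂

-- Counting partitions by their codes

infix 4 _≟ₛ_
_≟ₛ_ : ∀ {n} → DecidableEquality (Subset n)
_≟ₛ_ = Vec.≡-dec Bool._≟_

module SubsetWords {n} = Words (_≟ₛ_ {n})

unique-map : ∀ {A B : Set} {f : A → B} {xs} → Unique xs →
             (∀ {x y} → x ∈ xs → y ∈ xs → f x ≡ f y → x ≡ y) → Unique (map f xs)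
unique-map [] _ = []
unique-map (x∉xs ∷ xs!) inj =
  All.map⁺ (All.tabulate λ y∈ fx≡fy → All.lookup x∉xs y∈ (inj (here refl) (there y∈) fx≡fy))
  ∷ unique-map xs! λ x∈ y∈ → inj (there x∈) (there y∈)

∈-subsets : ∀ {n} (p : Subset n) → p ∈ subsets n
∈-subsets []            = here refl
∈-subsets (inside ∷ p)  = ∈-++⁺ˡ (∈-map⁺ (inside ∷_) (∈-subsets p))
∈-subsets (outside ∷ p) = ∈-++⁺ʳ (map (inside ∷_) (subsets _)) (∈-map⁺ (outside ∷_) (∈-subsets p))

subsets-unique : ∀ n → Unique (subsets n)
subsets-unique zero    = [] ∷ []
subsets-unique (suc n) = Unique.++⁺
  (Unique.map⁺ Vec.∷-injectiveʳ (subsets-unique n))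
  (Unique.map⁺ Vec.∷-injectiveʳ (subsets-unique n))
  λ (p , q) → let _ , _ , e  = ∈-map⁻ (inside ∷_) p
                  _ , _ , e′ = ∈-map⁻ (outside ∷_) q
              in case (Vec.∷-injectiveˡ (trans (sym e) e′)) of λ ()

module _ {A : Set} where

  ∈-sublists⇒⊆ : ∀ (xs : List A) {ys} → ys ∈ sublists xs → ys ⊆ xs
  ∈-sublists⇒⊆ [] (here refl) ()
  ∈-sublists⇒⊆ (x ∷ xs) ys∈ with ∈-++⁻ (map (x ∷_) (sublists xs)) ys∈
  ... | inj₂ ys∈′ = there ∘ ∈-sublists⇒⊆ xs ys∈′
  ... | inj₁ ys∈′ with _ , zs∈ , refl ← ∈-map⁻ (x ∷_) ys∈′ = λ where
    (here e)   → here e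
    (there y∈) → there (∈-sublists⇒⊆ xs zs∈ y∈)

  sublists-unique : ∀ {xs : List A} → Unique xs → Unique (sublists xs)
  sublists-unique [] = [] ∷ []
  sublists-unique {x ∷ xs} (x∉xs ∷ xs!) = Unique.++⁺
    (Unique.map⁺ ∷-injectiveʳ (sublists-unique xs!)) (sublists-unique xs!)
    λ (p , q) → let _ , _ , e = ∈-map⁻ (x ∷_) p in
      All.lookup x∉xs (∈-sublists⇒⊆ xs q (subst (x ∈_) (sym e) (here refl))) refl

  -- Reduces equality of two partitions drawn from `sublists (subsets n)` to their having the same
  -- parts.
  sublists-≡ : ∀ {xs ys zs : List A} → Unique xs → ys ∈ sublists xs → zs ∈ sublists xs →
               ys ⊆ zs → zs ⊆ ys → ys ≡ zs
  sublists-≡ [] (here refl) (here refl) _ _ = refl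
  sublists-≡ {x ∷ xs} (x∉xs ∷ xs!) ys∈ zs∈ ys⊆zs zs⊆ys
    with ∈-++⁻ (map (x ∷_) (sublists xs)) ys∈ | ∈-++⁻ (map (x ∷_) (sublists xs)) zs∈
  ... | inj₂ p | inj₂ q = sublists-≡ xs! p q ys⊆zs zs⊆ys
  ... | inj₁ p | inj₂ q with _ , _ , refl ← ∈-map⁻ (x ∷_) p =
    ⊥-elim (All.lookup x∉xs (∈-sublists⇒⊆ xs q (ys⊆zs (here refl))) refl)
  ... | inj₂ p | inj₁ q with _ , _ , refl ← ∈-map⁻ (x ∷_) q =
    ⊥-elim (All.lookup x∉xs (∈-sublists⇒⊆ xs p (zs⊆ys (here refl))) refl)
  ... | inj₁ p | inj₁ q with ys′ , p′ , refl ← ∈-map⁻ (x ∷_) p | zs′ , q′ , refl ← ∈-map⁻ (x ∷_) q =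
    cong (x ∷_) (sublists-≡ xs! p′ q′ (drop-head p′ ys⊆zs) (drop-head q′ zs⊆ys))
    where
    drop-head : ∀ {us vs} → us ∈ sublists xs → x ∷ us ⊆ x ∷ vs → us ⊆ vs
    drop-head us∈ us⊆vs u∈ with us⊆vs (there u∈)
    ... | there v∈ = v∈
    ... | here e   = contradiction (sym e) (All.lookup x∉xs (∈-sublists⇒⊆ xs us∈ u∈))

  filter-∈-sublists : ∀ {P : A → Set} (P? : ∀ x → Dec (P x)) xs → filter P? xs ∈ sublists xs
  filter-∈-sublists P? [] = here refl
  filter-∈-sublists P? (x ∷ xs) with does (P? x)
  ... | true  = ∈-++⁺ˡ (∈-map⁺ (x ∷_) (filter-∈-sublists P? xs))
  ... | false = ∈-++⁺ʳ (map (x ∷_) (sublists xs)) (filter-∈-sublists P? xs)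

allPairs-lookup : ∀ {A : Set} {R : A → A → Set} {xs} → AllPairs R xs →
                  ∀ {x y} → x ∈ xs → y ∈ xs → x ≡ y ⊎ R x y ⊎ R y x
allPairs-lookup (_ ∷ _)   (here refl) (here refl) = inj₁ refl
allPairs-lookup (Rx ∷ _)  (here refl) (there y∈)  = inj₂ (inj₁ (All.lookup Rx y∈))
allPairs-lookup (Ry ∷ _)  (there x∈)  (here refl) = inj₂ (inj₂ (All.lookup Ry x∈))
allPairs-lookup (_ ∷ Rxs) (there x∈)  (there y∈)  = allPairs-lookup Rxs x∈ y∈

partOf : ∀ {n} → List (Subset n) → Fin n → Subset n
-- A default value: in a partition some part contains `i`.
partOf []      i = Subset.⊥
partOf (p ∷ P) i with i Subset.∈? p
... | yes _ = p
... | no  _ = partOf P i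

partOf-∈ : ∀ {n} {P : List (Subset n)} {i} → Any (i Subset.∈_) P →
           partOf P i ∈ P × i Subset.∈ partOf P i
partOf-∈ {P = p ∷ P} {i} i∈ with i Subset.∈? p | i∈
... | yes i∈p | _ = here refl , i∈p
... | no i∉p  | here i∈p = contradiction i∈p i∉p
... | no _    | there i∈P with q∈ , i∈q ← partOf-∈ i∈P = there q∈ , i∈q

-- The partition becomes a word over the alphabet of subsets, each element being labelled by its own
-- part, so no numbering of the parts has to be chosen.
codeOf : ∀ {n} → List (Subset n) → List ℕ
codeOf P = SubsetWords.code (tabulate (partOf P))

module Partition {n k P} (P✓ : IsPartition n k P) where
  open IsPartition P✓

  part-unique : ∀ {i p q} → p ∈ P → q ∈ P → i Subset.∈ p → i Subset.∈ q → p ≡ q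
  part-unique p∈ q∈ i∈p i∈q with allPairs-lookup disjoint p∈ q∈
  ... | inj₁ p≡q       = p≡q
  ... | inj₂ (inj₁ p∩q) = contradiction (_ , Subset.x∈p∩q⁺ (i∈p , i∈q)) p∩q
  ... | inj₂ (inj₂ q∩p) = contradiction (_ , Subset.x∈p∩q⁺ (i∈q , i∈p)) q∩p

  partOf-≡ : ∀ {i p} → p ∈ P → i Subset.∈ p → partOf P i ≡ p
  partOf-≡ p∈ i∈p = let q∈ , i∈q = partOf-∈ (lose p∈ i∈p) in part-unique q∈ p∈ i∈q i∈p

  partOf-represents : ∀ i j → partOf P i ≡ partOf P j ⇔ SamePart P i j
  partOf-represents i j = mk⇔
    (λ e → let p∈ , i∈p = partOf-∈ (covers i) ; _ , j∈q = partOf-∈ (covers j) in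
       lose p∈ (i∈p , subst (j Subset.∈_) (sym e) j∈q))
    (λ s → let _ , p∈ , i∈p , j∈p = find s in trans (partOf-≡ p∈ i∈p) (sym (partOf-≡ p∈ j∈p)))

  parts-unique : Unique P
  parts-unique = go nonempty disjoint
    where
    go : ∀ {Q} → All Subset.Nonempty Q → AllPairs (λ p q → Subset.Empty (p Subset.∩ q)) Q → Unique Q
    go [] [] = []
    go ((_ , i∈p) ∷ ne) (p∩ ∷ dis) =
      All.map (λ { ¬p∩q refl → ¬p∩q (_ , Subset.x∈p∩q⁺ (i∈p , i∈p)) }) p∩ ∷ go ne dis

  -- The letters of the word are parts, and every part occurs as a letter because it is nonempty.
  -- Both lists are free of repetitions, so their lengths agree.
  dedup-partOf-length : length (SubsetWords.dedup (tabulate (partOf P))) ≡ k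
  dedup-partOf-length = trans (≤-antisym
    (unique-⊆-length (SubsetWords.dedup-unique (tabulate (partOf P))) λ q∈ →
       let i , e = ∈-tabulate⁻ (∈-deduplicate⁻ _≟ₛ_ _ q∈) in
       subst (_∈ P) (sym e) (proj₁ (partOf-∈ (covers i))))
    (unique-⊆-length parts-unique λ p∈ →
       let i , i∈p = All.lookup nonempty p∈ in
       ∈-deduplicate⁺ _≟ₛ_ (subst (_∈ tabulate (partOf P)) (partOf-≡ p∈ i∈p) (∈-tabulate⁺ i))))
    parts

  codeOf-isCode : IsCode k (codeOf P)
  codeOf-isCode = subst (λ l → IsCode l (codeOf P)) dedup-partOf-length (SubsetWords.code-isCode _)

  codeOf-∈ : codeOf P ∈ codes n k
  codeOf-∈ = subst (λ m → codeOf P ∈ codes m k)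
    (trans (SubsetWords.length-code (tabulate (partOf P))) (length-tabulate (partOf P)))
    (∈-codes⁺ codeOf-isCode)

-- Pick `i` in a part `p` of `P`. Both `p` and the part of `Q` around `i` consist of the elements
-- equivalent to `i`.
refines : ∀ {n k l P Q} → IsPartition n k P → IsPartition n l Q →
          (∀ i j → SamePart P i j ⇔ SamePart Q i j) → P ⊆ Q
refines {Q = Q} P✓ Q✓ P~Q {p} p∈
  with i , i∈p ← All.lookup (IsPartition.nonempty P✓) p∈
  with q , q∈ , i∈q ← find (IsPartition.covers Q✓ i)
  = subst (_∈ Q) (Subset.⊆-antisym
      (λ {j} j∈q → let r , r∈ , i∈r , j∈r = find (Equivalence.from (P~Q i j) (lose q∈ (i∈q , j∈q))) in
         subst (j Subset.∈_) (Partition.part-unique P✓ r∈ p∈ i∈r i∈p) j∈r)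
      (λ {j} j∈p → let r , r∈ , i∈r , j∈r = find (Equivalence.to (P~Q i j) (lose p∈ (i∈p , j∈p))) in
         subst (j Subset.∈_) (Partition.part-unique Q✓ r∈ q∈ i∈r i∈q) j∈r)) q∈

partitions : ∀ n k → List (List (Subset n))
partitions n k = filter (isPartition? n k) (sublists (subsets n))

codeOf-injective : ∀ {n k P Q} → P ∈ partitions n k → Q ∈ partitions n k → codeOf P ≡ codeOf Q → P ≡ Q
codeOf-injective {n} {k} {P} {Q} P∈ Q∈ eq
  with P∈s , P✓ ← ∈-filter⁻ (isPartition? n k) P∈
     | Q∈s , Q✓ ← ∈-filter⁻ (isPartition? n k) Q∈
  = sublists-≡ (subsets-unique n) P∈s Q∈s (refines P✓ Q✓ P~Q) (refines Q✓ P✓ λ i j → ⇔.sym (P~Q i j))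
  where
  P~Q : ∀ i j → SamePart P i j ⇔ SamePart Q i j
  P~Q i j = ⇔.trans (⇔.sym (Partition.partOf-represents P✓ i j))
           (⇔.trans (SamePattern.code-injective _≟ₛ_ _≟ₛ_ (partOf P) (partOf Q) eq i j)
                    (Partition.partOf-represents Q✓ i j))

module Kernel {A : Set} (_≟_ : DecidableEquality A) {n} (f : Vector A n) where

  fibre : Fin n → Subset n
  fibre i = Vec.tabulate λ j → does (f i ≟ f j)

  ∈-fibre⁺ : ∀ {i j} → f i ≡ f j → j Subset.∈ fibre i
  ∈-fibre⁺ {i} {j} e = Vec.lookup⇒[]= j _ (trans (Vec.lookup∘tabulate _ j) (dec-true (f i ≟ f j) e))

  ∈-fibre⁻ : ∀ {i j} → j Subset.∈ fibre i → f i ≡ f j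
  ∈-fibre⁻ {i} {j} j∈ with f i ≟ f j | trans (sym (Vec.lookup∘tabulate (λ j → does (f i ≟ f j)) j)) (Vec.[]=⇒lookup j∈)
  ... | yes e | _ = e

  isFibre? : ∀ p → Dec (∃ λ i → p ≡ fibre i)
  isFibre? p = Fin.any? λ i → p ≟ₛ fibre i

  -- Filtering `subsets n`, instead of listing the fibre of each `i`, avoids repetitions and makes
  -- the result a member of `sublists (subsets n)`.
  kernel : List (Subset n)
  kernel = filter isFibre? (subsets n)

  fibre-∈ : ∀ i → fibre i ∈ kernel
  fibre-∈ i = ∈-filter⁺ isFibre? (∈-subsets (fibre i)) (i , refl)

  kernel-isPartition : IsPartition n (length kernel) kernel
  kernel-isPartition = isPartition
    (All.map (λ {(i , refl) → i , ∈-fibre⁺ refl}) (All.all-filter isFibre? (subsets n)))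
    (disjoint (Unique.filter⁺ isFibre? (subsets-unique n)) (All.all-filter isFibre? (subsets n)))
    (λ i → lose (fibre-∈ i) (∈-fibre⁺ refl))
    refl
    where
    fibre-≡ : ∀ {i j l} → l Subset.∈ fibre i → l Subset.∈ fibre j → fibre i ≡ fibre j
    fibre-≡ {i} {j} l∈i l∈j = cong (λ x → Vec.tabulate λ m → does (x ≟ f m))
                                   (trans (∈-fibre⁻ l∈i) (sym (∈-fibre⁻ l∈j)))
    disjoint : ∀ {Q} → Unique Q → All (λ p → ∃ λ i → p ≡ fibre i) Q →
               AllPairs (λ p q → Subset.Empty (p Subset.∩ q)) Q
    disjoint [] [] = []
    disjoint (p∉ ∷ Q!) ((i , refl) ∷ Qf) = All.zipWith
      (λ { (p≢q , j , refl) (l , l∈) → let l∈i , l∈j = Subset.x∈p∩q⁻ (fibre i) (fibre j) l∈ in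
           p≢q (fibre-≡ l∈i l∈j) }) (p∉ , Qf) ∷ disjoint Q! Qf

  kernel-represents : ∀ i j → f i ≡ f j ⇔ SamePart kernel i j
  kernel-represents i j = mk⇔
    (λ e → lose (fibre-∈ i) (∈-fibre⁺ refl , ∈-fibre⁺ e))
    (λ s → let p , p∈ , i∈p , j∈p = find s
               _ , l , p≡ = ∈-filter⁻ isFibre? {xs = subsets n} p∈
           in trans (sym (∈-fibre⁻ (subst (i Subset.∈_) p≡ i∈p))) (∈-fibre⁻ (subst (j Subset.∈_) p≡ j∈p)))

-- The kernel of a decoded word has the equality pattern of that word, hence its code, and the code
-- fixes the number of parts.
codeOf-surjective : ∀ n k {cs} → cs ∈ codes n k → ∃ λ P → P ∈ partitions n k × codeOf P ≡ cs
codeOf-surjective n k {cs} cs∈ with refl , cs✓ ← ∈-codes⁻ n k cs∈ with f , e ← decode cs✓ =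
  kernel ,
  ∈-filter⁺ (isPartition? n k) (filter-∈-sublists isFibre? (subsets n))
    (subst (λ l → IsPartition n l kernel)
      (isCode-unique (subst (IsCode _) code≡ (Partition.codeOf-isCode kernel-isPartition)) cs✓)
      kernel-isPartition) ,
  code≡
  where
  open Kernel ℕ._≟_ f
  code≡ : codeOf kernel ≡ cs
  code≡ = trans (SamePattern.code-cong _≟ₛ_ ℕ._≟_ (partOf kernel) f λ i j →
                  ⇔.trans (Partition.partOf-represents kernel-isPartition i j)
                          (⇔.sym (kernel-represents i j))) e

-- `codeOf` is a bijection from the partitions to the codes: injectivity gives one inequality,
-- surjectivity the other.
S≡length-codes : ∀ n k → S n k ≡ length (codes n k)
S≡length-codes n k = ≤-antisym
  (subst (_≤ length (codes n k)) (length-map codeOf (partitions n k))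
    (unique-⊆-length
      (unique-map (Unique.filter⁺ (isPartition? n k) (sublists-unique (subsets-unique n))) codeOf-injective)
      λ c∈ → let P , P∈ , e = ∈-map⁻ codeOf c∈ in
        subst (_∈ codes n k) (sym e)
          (Partition.codeOf-∈ (proj₂ (∈-filter⁻ (isPartition? n k) {xs = sublists (subsets n)} P∈)))))
  (subst (length (codes n k) ≤_) (length-map codeOf (partitions n k))
    (unique-⊆-length (codes-unique n k) λ c∈ → let P , P∈ , e = codeOf-surjective n k c∈ in
      subst (_∈ map codeOf (partitions n k)) e (∈-map⁺ codeOf P∈)))

-- Stirling numbers modulo 2

stirlingℙ : ℕ → ℕ → Parity
stirlingℙ zero    zero    = 1ℙ
stirlingℙ zero    (suc k) = 0ℙ
stirlingℙ (suc n) zero    = 0ℙ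
stirlingℙ (suc n) (suc k) = parity (suc k) ⊗ stirlingℙ n (suc k) ⊕ stirlingℙ n k

length-cartesianProductWith : ∀ {A B C : Set} (f : A → B → C) xs ys →
  length (cartesianProductWith f xs ys) ≡ length xs * length ys
length-cartesianProductWith f []       ys = refl
length-cartesianProductWith f (x ∷ xs) ys = trans (length-++ (map (f x) ys))
  (cong₂ _+_ (length-map (f x) ys) (length-cartesianProductWith f xs ys))

parity-length-codes : ∀ n k → parity (length (codes n k)) ≡ stirlingℙ n k
parity-length-codes zero    zero    = refl
parity-length-codes zero    (suc k) = refl
parity-length-codes (suc n) zero    = refl
parity-length-codes (suc n) (suc k) = begin
  parity (length (cartesianProductWith _∷_ (downFrom (suc k)) olds ++ map (k ∷_) news))
    ≡⟨ cong parity (length-++ (cartesianProductWith _∷_ (downFrom (suc k)) olds)) ⟩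
  parity (length (cartesianProductWith _∷_ (downFrom (suc k)) olds) + length (map (k ∷_) news))
    ≡⟨ cong₂ (λ p q → parity (p + q))
         (trans (length-cartesianProductWith _∷_ (downFrom (suc k)) olds)
                (cong (_* length olds) (length-downFrom (suc k))))
         (length-map (k ∷_) news) ⟩
  parity (suc k * length olds + length news)
    ≡⟨ ℙ.+-homo-+ (suc k * length olds) (length news) ⟩
  parity (suc k * length olds) ⊕ parity (length news)
    ≡⟨ cong (_⊕ parity (length news)) (ℙ.*-homo-* (suc k) (length olds)) ⟩
  parity (suc k) ⊗ parity (length olds) ⊕ parity (length news)
    ≡⟨ cong₂ (λ p q → parity (suc k) ⊗ p ⊕ q) (parity-length-codes n (suc k)) (parity-length-codes n k) ⟩
  stirlingℙ (suc n) (suc k) ∎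
  where
  open ≡-Reasoning
  olds = codes n (suc k)
  news = codes n k

-- For the code of a window this is the number r of distinct letters before the next occurrence of
-- the first letter. The codes summed below are nonempty, so 0 is only a default.
headOr0 : List ℕ → ℕ
headOr0 []      = 0
headOr0 (c ∷ _) = c

sum-heads-∷ : ∀ c css → sum (map headOr0 (map (c ∷_) css)) ≡ c * length css
sum-heads-∷ c []         = sym (*-zeroʳ c)
sum-heads-∷ c (cs ∷ css) = trans (cong (c +_) (sum-heads-∷ c css)) (sym (*-suc c (length css)))

sum-heads-product : ∀ cs css →
  sum (map headOr0 (cartesianProductWith _∷_ cs css)) ≡ sum cs * length css
sum-heads-product []       css = refl
sum-heads-product (c ∷ cs) css = begin
  sum (map headOr0 (map (c ∷_) css ++ rest))
    ≡⟨ cong sum (map-++ headOr0 (map (c ∷_) css) rest) ⟩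
  sum (map headOr0 (map (c ∷_) css) ++ map headOr0 rest)
    ≡⟨ sum-++ (map headOr0 (map (c ∷_) css)) (map headOr0 rest) ⟩
  sum (map headOr0 (map (c ∷_) css)) + sum (map headOr0 rest)
    ≡⟨ cong₂ _+_ (sum-heads-∷ c css) (sum-heads-product cs css) ⟩
  c * length css + sum cs * length css
    ≡⟨ *-distribʳ-+ (length css) c (sum cs) ⟨
  (c + sum cs) * length css ∎
  where
  open ≡-Reasoning
  rest = cartesianProductWith _∷_ cs css

-- The binomial coefficient (n choose 2) modulo 2.
triangularℙ : ℕ → Parity
triangularℙ n = parity (sum (downFrom n))

-- In the first summand of `codes` each tail is preceded by every head from 0 to `k`; in the second
-- every head is `k`.
parity-sum-heads : ∀ n k → parity (sum (map headOr0 (codes (suc n) (suc k))))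
                         ≡ triangularℙ (suc k) ⊗ stirlingℙ n (suc k) ⊕ parity k ⊗ stirlingℙ n k
parity-sum-heads n k = begin
  parity (sum (map headOr0 (headed ++ map (k ∷_) news)))
    ≡⟨ cong (λ l → parity (sum l)) (map-++ headOr0 headed _) ⟩
  parity (sum (map headOr0 headed ++ map headOr0 (map (k ∷_) news)))
    ≡⟨ cong parity (sum-++ (map headOr0 headed) _) ⟩
  parity (sum (map headOr0 headed) + sum (map headOr0 (map (k ∷_) news)))
    ≡⟨ cong₂ (λ p q → parity (p + q)) (sum-heads-product (downFrom (suc k)) olds) (sum-heads-∷ k news) ⟩
  parity (sum (downFrom (suc k)) * length olds + k * length news)
    ≡⟨ ℙ.+-homo-+ (sum (downFrom (suc k)) * length olds) (k * length news) ⟩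
  parity (sum (downFrom (suc k)) * length olds) ⊕ parity (k * length news)
    ≡⟨ cong₂ _⊕_ (ℙ.*-homo-* (sum (downFrom (suc k))) (length olds)) (ℙ.*-homo-* k (length news)) ⟩
  triangularℙ (suc k) ⊗ parity (length olds) ⊕ parity k ⊗ parity (length news)
    ≡⟨ cong₂ (λ p q → triangularℙ (suc k) ⊗ p ⊕ parity k ⊗ q)
         (parity-length-codes n (suc k)) (parity-length-codes n k) ⟩
  triangularℙ (suc k) ⊗ stirlingℙ n (suc k) ⊕ parity k ⊗ stirlingℙ n k ∎
  where
  open ≡-Reasoning
  olds = codes n (suc k)
  news = codes n k
  headed = cartesianProductWith _∷_ (downFrom (suc k)) olds

parity-suc : ∀ n → parity (suc n) ≡ 1ℙ ⊕ parity n
parity-suc = ℙ.+-homo-+ 1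

-- Modulo 2, column k has generating function x^k / (1 - x)^⌈k/2⌉, so four columns
-- multiply it by x⁴ / (1 - x)² = x⁴ / (1 - x²).
stirlingℙ-4+ : ∀ n k → stirlingℙ (4 + n) (4 + k) ≡ stirlingℙ (2 + n) (4 + k) ⊕ stirlingℙ n k
stirlingℙ-4+ n k with parity k | parity (suc k) | parity-suc k
... | 0ℙ | _ | refl = even (s 1) (s 0) (s 2) (s 3)
  where
  s : ℕ → Parity
  s j = stirlingℙ n (j + k)
  even : ∀ a₁ a₀ a₂ a₃ → ((a₃ ⊕ a₂) ⊕ a₁) ⊕ (a₁ ⊕ a₀) ≡ (a₃ ⊕ a₂) ⊕ a₀
  even = solve-∀ ℤ₂
... | 1ℙ | _ | refl = odd (s 0) (s 1) (s 2) (s 3) (s 4)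
  where
  s : ℕ → Parity
  s j = stirlingℙ n (j + k)
  odd : ∀ a₀ a₁ a₂ a₃ a₄ → (((a₄ ⊕ a₃) ⊕ a₂) ⊕ (a₂ ⊕ a₁)) ⊕ ((a₂ ⊕ a₁) ⊕ a₀) ≡ ((a₄ ⊕ a₃) ⊕ a₂) ⊕ a₀
  odd = solve-∀ ℤ₂

-- The four additional terms add up to an even number. The period 4 matches the column step of
-- `stirlingℙ-4+`.
triangularℙ-4+ : ∀ n → triangularℙ (4 + n) ≡ triangularℙ n
triangularℙ-4+ n = begin
  parity (3 + n + (2 + n + (1 + n + (n + t))))
    ≡⟨ cong parity (rearrange n t) ⟩
  parity ((3 + n + n) * 2 + t)
    ≡⟨ ℙ.+-homo-+ ((3 + n + n) * 2) t ⟩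
  parity ((3 + n + n) * 2) ⊕ parity t
    ≡⟨ cong (_⊕ parity t) (trans (ℙ.*-homo-* (3 + n + n) 2) (ℙ.*-zeroʳ (parity (3 + n + n)))) ⟩
  parity t ∎
  where
  open ≡-Reasoning
  t = sum (downFrom n)
  rearrange : ∀ n t → 3 + n + (2 + n + (1 + n + (n + t))) ≡ (3 + n + n) * 2 + t
  rearrange = ℕ-Solver.solve-∀

stirlingℙ-< : ∀ {n k} → n ℕ.< k → stirlingℙ n k ≡ 0ℙ
stirlingℙ-< {zero}  {suc k} _ = refl
stirlingℙ-< {suc n} {suc k} (ℕ.s≤s n<k)
  rewrite stirlingℙ-< {n} {suc k} (m<n⇒m<1+n n<k) | stirlingℙ-< n<k =
  cong (_⊕ 0ℙ) (ℙ.*-zeroʳ (parity (suc k)))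

stirlingℙ-1 : ∀ n → stirlingℙ (1 + n) 1 ≡ 1ℙ
stirlingℙ-1 zero    = refl
stirlingℙ-1 (suc n) = cong (_⊕ 0ℙ) (stirlingℙ-1 n)

-- Modulo 2, column 2 is constantly 1 from row 2 on, so column 3 alternates.
stirlingℙ-3-even : ∀ n → parity n ≡ 0ℙ → stirlingℙ (2 + n) 3 ≡ 0ℙ
stirlingℙ-3-even zero          _ = refl
stirlingℙ-3-even (suc (suc n)) e rewrite stirlingℙ-3-even n e | stirlingℙ-1 n = refl

stirlingℙ-head-sum-< : ∀ {n r} → n ℕ.< r →
  stirlingℙ n r ≡ triangularℙ (2 + r) ⊗ stirlingℙ (1 + n) (2 + r) ⊕ parity (1 + r) ⊗ stirlingℙ (1 + n) (1 + r)
stirlingℙ-head-sum-< {n} {r} n<r = trans (stirlingℙ-< n<r) (sym (trans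
  (cong₂ (λ x y → triangularℙ (2 + r) ⊗ x ⊕ parity (1 + r) ⊗ y)
         (stirlingℙ-< (ℕ.s<s (m<n⇒m<1+n n<r))) (stirlingℙ-< (ℕ.s<s n<r)))
  (zeros (triangularℙ (2 + r)) (parity (1 + r)))))
  where
  zeros : ∀ p q → p ⊗ 0ℙ ⊕ q ⊗ 0ℙ ≡ 0ℙ
  zeros = solve-∀ ℤ₂

-- Both sides obey the recurrence of `stirlingℙ-4+`: on the right the coefficients do not change
-- when `r` grows by 4, so the recurrence passes through them. What remains are the columns below 4
-- and the rows 0 and 2.
stirlingℙ-head-sum : ∀ n r → parity n ≡ 0ℙ →
  stirlingℙ n r ≡ triangularℙ (2 + r) ⊗ stirlingℙ (1 + n) (2 + r) ⊕ parity (1 + r) ⊗ stirlingℙ (1 + n) (1 + r)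
stirlingℙ-head-sum zero          0 _ = refl
stirlingℙ-head-sum (suc (suc n)) 0 _ rewrite stirlingℙ-1 n = refl
stirlingℙ-head-sum zero          1 _ = refl
stirlingℙ-head-sum (suc (suc n)) 1 e rewrite stirlingℙ-3-even n e | stirlingℙ-1 n = refl
stirlingℙ-head-sum zero          2 _ = refl
stirlingℙ-head-sum (suc (suc n)) 2 e rewrite stirlingℙ-3-even n e | stirlingℙ-1 n = refl
stirlingℙ-head-sum zero          3 _ = refl
stirlingℙ-head-sum (suc (suc n)) 3 e rewrite stirlingℙ-3-even n e = refl
-- In rows 0 and 2 with column at least 4 every Stirling number involved has more parts than
-- elements.
stirlingℙ-head-sum 0 (suc (suc (suc (suc r)))) _ = stirlingℙ-head-sum-< {r = 4 + r} ℕ.z<s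
stirlingℙ-head-sum 2 (suc (suc (suc (suc r)))) _ = stirlingℙ-head-sum-< {r = 4 + r} (ℕ.s<s (ℕ.s<s ℕ.z<s))
stirlingℙ-head-sum (suc (suc (suc (suc n)))) (suc (suc (suc (suc r)))) e = begin
  s (4 + n) (4 + r)
    ≡⟨ stirlingℙ-4+ n r ⟩
  s (2 + n) (4 + r) ⊕ s n r
    ≡⟨ cong₂ _⊕_ (stirlingℙ-head-sum (suc (suc n)) (suc (suc (suc (suc r)))) e) (stirlingℙ-head-sum n r e) ⟩
  (triangularℙ (6 + r) ⊗ s (3 + n) (6 + r) ⊕ p ⊗ s (3 + n) (5 + r)) ⊕ (triangularℙ (2 + r) ⊗ s (1 + n) (2 + r) ⊕ p ⊗ s (1 + n) (1 + r))
    ≡⟨ cong (λ t → (triangularℙ (6 + r) ⊗ s (3 + n) (6 + r) ⊕ p ⊗ s (3 + n) (5 + r)) ⊕ (t ⊗ s (1 + n) (2 + r) ⊕ p ⊗ s (1 + n) (1 + r))) (triangularℙ-4+ (2 + r)) ⟨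
  (t ⊗ s (3 + n) (6 + r) ⊕ p ⊗ s (3 + n) (5 + r)) ⊕ (t ⊗ s (1 + n) (2 + r) ⊕ p ⊗ s (1 + n) (1 + r))
    ≡⟨ rearrange t p (s (3 + n) (6 + r)) (s (3 + n) (5 + r)) (s (1 + n) (2 + r)) (s (1 + n) (1 + r)) ⟩
  t ⊗ (s (3 + n) (6 + r) ⊕ s (1 + n) (2 + r)) ⊕ p ⊗ (s (3 + n) (5 + r) ⊕ s (1 + n) (1 + r))
    ≡⟨ cong₂ (λ x y → t ⊗ x ⊕ p ⊗ y) (stirlingℙ-4+ (1 + n) (2 + r)) (stirlingℙ-4+ (1 + n) (1 + r)) ⟨
  t ⊗ s (5 + n) (6 + r) ⊕ p ⊗ s (5 + n) (5 + r) ∎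
  where
  open ≡-Reasoning
  s = stirlingℙ
  t = triangularℙ (6 + r)
  p = parity (1 + r)
  rearrange : ∀ t p w x y z → (t ⊗ w ⊕ p ⊗ x) ⊕ (t ⊗ y ⊕ p ⊗ z) ≡ t ⊗ (w ⊕ y) ⊕ p ⊗ (x ⊕ z)
  rearrange = solve-∀ ℤ₂

-- Windows of a cyclic string

sum-telescope : ∀ (f : ℕ → ℕ) (g : ℕ → Parity) → (∀ m → g m ⊕ g (suc m) ≡ parity (f m)) →
                ∀ N → parity (sum (tabulate {n = N} (f ∘ toℕ))) ≡ g 0 ⊕ g N
sum-telescope f g step zero    = sym (ℙ.p+p≡0ℙ (g 0))
sum-telescope f g step (suc N) = begin
  parity (f 0 + sum (tabulate {n = N} (f ∘ suc ∘ toℕ)))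
    ≡⟨ ℙ.+-homo-+ (f 0) _ ⟩
  parity (f 0) ⊕ parity (sum (tabulate {n = N} (f ∘ suc ∘ toℕ)))
    ≡⟨ cong₂ _⊕_ (sym (step 0)) (sum-telescope (f ∘ suc) (g ∘ suc) (step ∘ suc) N) ⟩
  (g 0 ⊕ g 1) ⊕ (g 1 ⊕ g (suc N))
    ≡⟨ cancel (g 0) (g 1) (g (suc N)) ⟩
  g 0 ⊕ g (suc N) ∎
  where
  open ≡-Reasoning
  cancel : ∀ p q r → (p ⊕ q) ⊕ (q ⊕ r) ≡ p ⊕ r
  cancel = solve-∀ ℤ₂

segment : ∀ {A : Set} → (ℕ → A) → ℕ → ℕ → List A
segment b m zero    = []
segment b m (suc l) = b m ∷ segment b (suc m) l

segment-snoc : ∀ {A : Set} (b : ℕ → A) m l → segment b m (suc l) ≡ segment b m l ++ b (m + l) ∷ []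
segment-snoc b m zero    = cong (λ j → b j ∷ []) (sym (+-identityʳ m))
segment-snoc b m (suc l) = cong (b m ∷_) (trans (segment-snoc b (suc m) l)
  (cong (λ j → segment b (suc m) l ++ b j ∷ []) (sym (+-suc m l))))

segment-tabulate : ∀ {A : Set} (b : ℕ → A) m l → segment b m l ≡ tabulate {n = l} (λ j → b (m + toℕ j))
segment-tabulate b m zero    = refl
segment-tabulate b m (suc l) = cong₂ _∷_ (cong b (sym (+-identityʳ m)))
  (trans (segment-tabulate b (suc m) l) (tabulate-cong λ j → cong b (sym (+-suc m (toℕ j)))))

module _ {k : ℕ} where
  open Words (Fin._≟_ {k})
  open Inversions {k}

  -- The words `x ∷ v` and `v ++ y ∷ []` are consecutive windows. Each contains all letters, so each
  -- carries a full ordering, and moving `x` to the front turns the later ordering into the earlier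
  -- one.
  inversions-shift : ∀ {x y} v → (∀ z → z ∈ x ∷ v) → (∀ z → z ∈ v ++ y ∷ []) →
    inversions (dedup (x ∷ v)) ⊕ inversions (dedup (v ++ y ∷ [])) ≡ parity (rank x (dedup v))
  inversions-shift {x} {y} v xv vy with Any.any? (y Fin.≟_) v
  ... | yes y∈v rewrite dedup-snoc-∈ v y∈v =
    inversions-move (dedup-unique v)
      (∈-deduplicate⁺ Fin._≟_ (case-snoc (∈-++⁻ v (vy x))))
    where
    case-snoc : x ∈ v ⊎ x ∈ y ∷ [] → x ∈ v
    case-snoc (inj₁ x∈v)         = x∈v
    case-snoc (inj₂ (here refl)) = y∈v
  -- The earlier window contains `y`, so `y` must be `x`. It then stands last in the later ordering,
  -- where its rank equals the code of a letter absent from `v`.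
  ... | no y∉v with xv y
  ... | there y∈v = contradiction y∈v y∉v
  ... | here refl = begin
    inversions (x ∷ remove x (dedup v)) ⊕ inversions (dedup (v ++ x ∷ []))
      ≡⟨ cong (λ L → inversions (x ∷ L) ⊕ inversions (dedup (v ++ x ∷ []))) remove-snoc ⟨
    inversions (x ∷ remove x (dedup (v ++ x ∷ []))) ⊕ inversions (dedup (v ++ x ∷ []))
      ≡⟨ inversions-move (dedup-unique (v ++ x ∷ [])) (∈-deduplicate⁺ Fin._≟_ (vy x)) ⟩
    parity (rank x (dedup (v ++ x ∷ [])))
      ≡⟨ cong (parity ∘ rank x) (dedup-snoc-∉ v y∉v) ⟩
    parity (rank x (dedup v ++ x ∷ []))
      ≡⟨ cong parity (rank-∉-snoc (dedup v) x∉) ⟩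
    parity (rank x (dedup v)) ∎
    where
    open ≡-Reasoning
    x∉ : x ∉ dedup v
    x∉ = y∉v ∘ ∈-deduplicate⁻ Fin._≟_ v
    remove-snoc : remove x (dedup (v ++ x ∷ [])) ≡ remove x (dedup v)
    remove-snoc = ∷-injectiveʳ (dedup-snoc-∈ (x ∷ v) (here refl))

  -- Summing the sign changes over one turn telescopes, and the orderings at positions 0 and `N`
  -- coincide.
  windows-even : ∀ {N} n (a : Vector (Fin k) N) →
    (∀ i x → x ∈ tabulate (window (suc n) a i)) →
    parity (sum (tabulate λ i → headOr0 (code (tabulate (window (suc n) a i))))) ≡ 0ℙ
  windows-even {zero}  n a _     = refl
  windows-even {N@(suc _)} n a total = begin
    parity (sum (tabulate λ i → headOr0 (code (tabulate (window (suc n) a i)))))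
      ≡⟨ cong (parity ∘ sum) (tabulate-cong {n = N} λ i → cong (headOr0 ∘ code) (segment-tabulate b (toℕ i) (suc n))) ⟨
    parity (sum (tabulate {n = N} (ranks ∘ toℕ)))
      ≡⟨ sum-telescope ranks invs step N ⟩
    invs 0 ⊕ invs N
      ≡⟨ cong (λ v → invs 0 ⊕ inversions (dedup v)) periodic ⟩
    invs 0 ⊕ invs 0
      ≡⟨ ℙ.p+p≡0ℙ (invs 0) ⟩
    0ℙ ∎
    where
    open ≡-Reasoning
    -- The cyclic string is unrolled to a periodic sequence, so that consecutive windows overlap
    -- without a case for wrapping around.
    b : ℕ → Fin k
    b m = a (m mod N)
    ranks : ℕ → ℕ
    ranks m = rank (b m) (dedup (segment b (suc m) n))
    invs : ℕ → Parity
    invs m = inversions (dedup (segment b m (suc n)))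
    mod-cong : ∀ l m → l % N ≡ m % N → l mod N ≡ m mod N
    mod-cong _ _ e = Fin.fromℕ<-cong _ _ e _ _
    segment-mod : ∀ m → segment b m (suc n) ≡ tabulate (window (suc n) a (m mod N))
    segment-mod m = trans (segment-tabulate b m (suc n)) (tabulate-cong λ j → cong a (mod-cong (m + toℕ j) (toℕ (m mod N) + toℕ j) (begin
      (m + toℕ j) % N               ≡⟨ %-distribˡ-+ m (toℕ j) N ⟩
      (m % N + toℕ j % N) % N       ≡⟨ cong (λ r → (r + toℕ j % N) % N) (m%n%n≡m%n m N) ⟨
      (m % N % N + toℕ j % N) % N   ≡⟨ %-distribˡ-+ (m % N) (toℕ j) N ⟨
      (m % N + toℕ j) % N           ≡⟨ cong (λ r → (r + toℕ j) % N) (Fin.toℕ-fromℕ< (m%n<n m N)) ⟨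
      (toℕ (m mod N) + toℕ j) % N   ∎)))
    periodic : segment b N (suc n) ≡ segment b 0 (suc n)
    periodic = trans (segment-mod N) (trans
      (cong (λ i → tabulate (window (suc n) a i)) (mod-cong N 0 (n%n≡0 N)))
      (sym (segment-mod 0)))
    total′ : ∀ m x → x ∈ segment b m (suc n)
    total′ m x = subst (x ∈_) (sym (segment-mod m)) (total (m mod N) x)
    step : ∀ m → invs m ⊕ invs (suc m) ≡ parity (ranks m)
    step m = trans
      (cong (λ v → invs m ⊕ inversions (dedup v)) (segment-snoc b (suc m) n))
      (inversions-shift (segment b (suc m) n) (total′ m)
        λ x → subst (x ∈_) (segment-snoc b (suc m) n) (total′ (suc m) x))

-- Windows of a ucycle, and the contradiction

module Ucycle {n k} (a : Vector (Fin k) (S n k)) (ucycle : IsUcycle n k a) where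
  open Words (Fin._≟_ {k})

  windowCode : Fin (S n k) → List ℕ
  windowCode i = code (tabulate (window n a i))

  -- Every code belongs to a partition, which some window represents. There are as many windows as
  -- codes, so each code occurs exactly once.
  windowCodes-↭ : tabulate windowCode ↭ codes n k
  windowCodes-↭ = unique-⊆-↭ (codes-unique n k)
    (λ c∈ → let P , P∈ , codeP≡c = codeOf-surjective n k c∈
                P✓ = proj₂ (∈-filter⁻ (isPartition? n k) {xs = sublists (subsets n)} P∈)
                i , represents , _ = ucycle P P✓
            in subst (_∈ tabulate windowCode)
                 (trans (SamePattern.code-cong Fin._≟_ _≟ₛ_ (window n a i) (partOf P)
                          λ j l → ⇔.trans (represents j l) (⇔.sym (Partition.partOf-represents P✓ j l)))
                        codeP≡c)
                 (∈-tabulate⁺ i))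
    (≤-reflexive (trans (length-tabulate windowCode) (S≡length-codes n k)))

  -- The code of the window is that of a partition into `k` parts, so the window has `k` distinct
  -- letters, which exhaust the alphabet.
  window-total : ∀ i x → x ∈ tabulate (window n a i)
  window-total i x = ∈-deduplicate⁻ Fin._≟_ v (∈-resp-↭
    (unique-⊆-↭ (dedup-unique v) (λ {y} _ → ∈-allFin y)
      (≤-reflexive (trans (length-tabulate id) (sym length≡k))))
    (∈-allFin x))
    where
    v : List (Fin k)
    v = tabulate (window n a i)
    length≡k : length (dedup v) ≡ k
    length≡k = isCode-unique (code-isCode v)
      (proj₂ (∈-codes⁻ n k (∈-resp-↭ windowCodes-↭ (∈-tabulate⁺ i))))

even⇒2∣ : ∀ n → parity n ≡ 0ℙ → 2 ∣ n
even⇒2∣ zero          _ = 2 ∣0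
even⇒2∣ (suc (suc n)) e = ∣m∣n⇒∣m+n ∣-refl (even⇒2∣ n e)

2∣⇒even : ∀ {n} → 2 ∣ n → parity n ≡ 0ℙ
2∣⇒even (divides q refl) = trans (ℙ.*-homo-* q 2) (ℙ.*-zeroʳ (parity q))

corollary19 : (n k : ℕ) → 2 ≤ k → k < n →
    2 ∣ n → 2 ∤ S (n ∸ 2) (k ∸ 2) →
    ¬ (∃ λ (a : Vector (Fin k) (S n k)) → IsUcycle n k a)
-- After matching, `n` and `k` are the original parameters minus 2, so `S n k` is the number assumed
-- odd. The chain identifies its parity with that of the sum of the r over all windows.
corollary19 (suc (suc n)) (suc (suc k)) (s≤s (s≤s _)) (s≤s (s≤s _)) 2∣n 2∤S (a , ucycle) = 2∤S (even⇒2∣ _ (begin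
  parity (S n k)                                   ≡⟨ cong parity (S≡length-codes n k) ⟩
  parity (length (codes n k))                      ≡⟨ parity-length-codes n k ⟩
  stirlingℙ n k                                    ≡⟨ stirlingℙ-head-sum n k (2∣⇒even 2∣n) ⟩
  triangularℙ (2 + k) ⊗ stirlingℙ (1 + n) (2 + k) ⊕ parity (1 + k) ⊗ stirlingℙ (1 + n) (1 + k)
                                                   ≡⟨ parity-sum-heads (1 + n) (1 + k) ⟨
  parity (sum (map headOr0 (codes (2 + n) (2 + k)))) ≡⟨ cong parity (sum-↭ (map⁺ headOr0 windowCodes-↭)) ⟨
  parity (sum (map headOr0 (tabulate windowCode)))   ≡⟨ cong (parity ∘ sum) (map-tabulate windowCode headOr0) ⟩
  parity (sum (tabulate (headOr0 ∘ windowCode)))     ≡⟨ windows-even (suc n) a window-total ⟩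
  0ℙ ∎))
  where
  open ≡-Reasoning
  open Ucycle {2 + n} {2 + k} a ucycle
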